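{- Let $\Delta,n\in\mathbb{N}$ with $3\leq \Delta\leq n-2$ and let $G$ be a connected graph on $n$ vertices with maximum degree $\Delta$. Let $\alpha$ be chosen uniformly at random from the set $\Omega(G)$ of proper $(\Delta+1)$-colourings of $G$. Then $$\mathbb{P}(\alpha \text{ is frozen})\leq (6/7)^{\frac{n}{\Delta+1}}.$$
   Context: All graphs are finite, simple and labeled, with vertex set $[n]=\{1,\dots,n\}$. A (proper) $k$-colouring of $G$ is a function $\alpha:V(G)\to[k]$ with $\alpha(x)\neq\alpha(y)$ for every edge $xy$. For a graph $G$ of maximum degree $\Delta$, $\Omega(G)$ denotes the set of proper $(\Delta+1)$-colourings of $G$. A colouring $\alpha\in\Omega(G)$ is frozen if for every vertex $v$ all $\Delta+1$ colours appear in the closed neighbourhood $N[v]=N(v)\cup\{v\}$. -}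

module Defs where

open import Algebra.Definitions.RawSemiring using (_^_)
open import Data.Fin using (Fin; zero; toℕ; fromℕ<; finToFun; funToFin)
import Data.Fin.Properties as Fin
open import Data.Integer using (+_)
open import Data.List using (List; length; filter; map; allFin; lookup)
open import Data.List.Extrema.Nat using (max; xs≤max)
open import Data.List.Membership.Propositional using (_∈_; _∉_)
open import Data.List.Membership.Propositional.Properties
  using (∈-map⁺; ∈-filter⁺; ∈-allFin)
open import Data.List.Membership.DecPropositional using (_∈?_)
open import Data.List.Properties using (length-map)
import Data.List.Relation.Unary.All as All
open import Data.List.Relation.Unary.Any using (here; there; index)
open import Data.List.Relation.Unary.Any.Properties using (lookup-index)
open import Data.Nat as ℕ using (ℕ; zero; suc; NonZero; _≤_; _<_; s≤s)
import Data.Nat.Properties as ℕ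
open import Data.Product using (∃; _×_; _,_; proj₁; proj₂)
open import Data.Rational as ℚ using (ℚ)
open import Data.Sum using (_⊎_)
open import Function using (_∘_)
open import Level using (0ℓ)
open import Relation.Binary.Construct.Closure.ReflexiveTransitive using (Star)
open import Relation.Binary.Core using (Rel)
import Relation.Binary.Definitions as B
open import Relation.Binary.PropositionalEquality
  using (_≡_; _≢_; _≗_; sym; trans; cong; subst)
open import Relation.Nullary using (yes; no; ¬?; contradiction)
open import Relation.Nullary.Decidable using (_→-dec_; _×-dec_; _⊎-dec_; decidable-stable)
open import Relation.Unary using (Pred; Decidable)

record Graph (n : ℕ) : Set₁ where
  infix 4 _~_ _~?_
  field
    _~_      : Rel (Fin n) 0ℓ
    _~?_     : B.Decidable _~_
    ~-sym    : B.Symmetric _~_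
    ~-irrefl : B.Irreflexive _≡_ _~_

module _ {n : ℕ} (G : Graph n) where
  open Graph G

  neighbours : Fin n → List (Fin n)
  neighbours v = filter (v ~?_) (allFin n)

  degree : Fin n → ℕ
  degree v = length (neighbours v)

  maxDegree : ℕ
  maxDegree = max 0 (map degree (allFin n))

  Connected : Set
  Connected = ∀ u v → Star _~_ u v

  Proper : {k : ℕ} → Pred (Fin n → Fin k) 0ℓ
  Proper α = ∀ x y → x ~ y → α x ≢ α y

  proper? : {k : ℕ} → Decidable (Proper {k})
  proper? α = Fin.all? λ x → Fin.all? λ y → (x ~? y) →-dec ¬? (α x Fin.≟ α y)

  _∈N[_] : Fin n → Fin n → Set
  u ∈N[ v ] = u ≡ v ⊎ v ~ u

  Frozen : Pred (Fin n → Fin (suc maxDegree)) 0ℓ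
  Frozen α = ∀ v c → ∃ λ u → u ∈N[ v ] × α u ≡ c

  frozen? : Decidable Frozen
  frozen? α = Fin.all? λ v → Fin.all? λ c → Fin.any? λ u →
    (u Fin.≟ v ⊎-dec v ~? u) ×-dec (α u Fin.≟ c)

-- Via the bijection `finToFun`, every function occurs exactly once in this
-- list, up to pointwise equality.
allFunctions : (n k : ℕ) → List (Fin n → Fin k)
allFunctions n k = map finToFun (allFin (k ℕ.^ n))

Ω : {n : ℕ} (G : Graph n) → List (Fin n → Fin (suc (maxDegree G)))
Ω {n} G = filter (proper? G) (allFunctions n (suc (maxDegree G)))

-- Ω G is nonempty: colour the vertices greedily in the order 0, 1, …, n - 1.
module _ {n : ℕ} (G : Graph n) where
  open Graph G

  private
    degree≤maxDegree : ∀ v → degree G v ≤ maxDegree G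
    degree≤maxDegree v =
      All.lookup (xs≤max 0 (map (degree G) (allFin n))) (∈-map⁺ (degree G) (∈-allFin v))

    fresh : {k : ℕ} (xs : List (Fin k)) → length xs < k → ∃ (_∉ xs)
    fresh {k} xs xs<k with Fin.any? (λ c → ¬? (_∈?_ Fin._≟_ c xs))
    ... | yes p = p
    ... | no ¬p = contradiction i≡j (Fin.<⇒≢ i<j)
      where
      mem : ∀ c → c ∈ xs
      mem c = decidable-stable (_∈?_ Fin._≟_ c xs) (λ c∉ → ¬p (c , c∉))
      coll = Fin.pigeonhole xs<k (index ∘ mem)
      i = proj₁ coll
      j = proj₁ (proj₂ coll)
      i<j = proj₁ (proj₂ (proj₂ coll))
      i≡j : i ≡ j
      i≡j = trans (lookup-index (mem i))
              (trans (cong (lookup xs) (proj₂ (proj₂ (proj₂ coll))))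
                     (sym (lookup-index (mem j))))

    Colouring : Set
    Colouring = Fin n → Fin (suc (maxDegree G))

    ProperBelow : ℕ → Pred Colouring 0ℓ
    ProperBelow m α = ∀ x y → toℕ x < m → toℕ y < m → x ~ y → α x ≢ α y

    recolour : Colouring → Fin n → Fin (suc (maxDegree G)) → Colouring
    recolour α v c x with x Fin.≟ v
    ... | yes _ = c
    ... | no  _ = α x

    greedy : ∀ m → m ≤ n → ∃ (ProperBelow m)
    greedy zero    _   = (λ _ → zero) , λ _ _ ()
    greedy (suc m) m<n = recolour α v c , ok
      where
      ih = greedy m (ℕ.<⇒≤ m<n)
      α = proj₁ ih
      v = fromℕ< m<n
      used = map α (neighbours G v)
      choice = fresh used (s≤s (subst (_≤ maxDegree G)
        (sym (length-map α (neighbours G v))) (degree≤maxDegree v)))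
      c = proj₁ choice

      c≢ : ∀ y → v ~ y → c ≢ α y
      c≢ y v~y c≡ = proj₂ choice
        (subst (_∈ used) (sym c≡) (∈-map⁺ α (∈-filter⁺ (v ~?_) (∈-allFin y) v~y)))

      below : ∀ x → toℕ x < suc m → x ≢ v → toℕ x < m
      below x (s≤s x≤m) x≢v = ℕ.≤∧≢⇒< x≤m λ x≡m →
        x≢v (Fin.toℕ-injective (trans x≡m (sym (Fin.toℕ-fromℕ< m<n))))

      ok : ProperBelow (suc m) (recolour α v c)
      ok x y x< y< x~y with x Fin.≟ v | y Fin.≟ v
      ... | yes x≡v | yes y≡v = λ _ → ~-irrefl (trans x≡v (sym y≡v)) x~y
      ... | yes x≡v | no  _   = c≢ y (subst (_~ y) x≡v x~y)
      ... | no  _   | yes y≡v = λ e → c≢ x (subst (_~ x) y≡v (~-sym x~y)) (sym e)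
      ... | no x≢v  | no y≢v  = proj₂ ih x y (below x x< x≢v) (below y y< y≢v) x~y

    ∈⇒NonZero : {A : Set} {x : A} {xs : List A} → x ∈ xs → NonZero (length xs)
    ∈⇒NonZero (here  _) = _
    ∈⇒NonZero (there _) = _

  Ω-nonZero : NonZero (length (Ω G))
  Ω-nonZero = ∈⇒NonZero
    (∈-filter⁺ (proper? G) (∈-map⁺ finToFun (∈-allFin (funToFin α))) proper)
    where
    α : Colouring
    α = proj₁ (greedy n ℕ.≤-refl)
    β : Colouring
    β = finToFun (funToFin α)
    β≗α : β ≗ α
    β≗α = Fin.finToFun-funToFin α
    proper : Proper G β
    proper x y x~y e = proj₂ (greedy n ℕ.≤-refl) x y (Fin.toℕ<n x) (Fin.toℕ<n y) x~y
      (trans (sym (β≗α x)) (trans e (β≗α y)))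

-- ℙ G P? is the probability that P holds for a uniformly random element of Ω G.
ℙ : ∀ {n p} (G : Graph n) {P : Pred (Fin n → Fin (suc (maxDegree G))) p} →
    Decidable P → ℚ
ℙ G P? = (+ length (filter P? (Ω G)) ℚ./ length (Ω G)) {{Ω-nonZero G}}

-- For q, a ≥ 0 and d ≥ 1, `q ≤ a ^[ m / d ]` is the inequality q ≤ a^(m/d) of
-- real numbers: a^(m/d) is the nonnegative real whose d-th power is a^m, and
-- t ↦ t^d is strictly increasing for t ≥ 0.
infix 4 _≤_^[_/_]
_≤_^[_/_] : ℚ → ℚ → (m d : ℕ) .{{_ : NonZero d}} → Set
q ≤ a ^[ m / d ] = q ^ℚ d ℚ.≤ a ^ℚ m
  where
  _^ℚ_ : ℚ → ℕ → ℚ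
  _^ℚ_ = _^_ ℚ.+-*-rawSemiring

{-# OPTIONS --safe #-}

-- In a frozen colouring every closed neighbourhood carries each colour exactly
-- once.  Hence G is Δ-regular, and the closed neighbourhoods of the vertices of
-- colour 0 partition the vertices into blocks of size Δ + 1.  As G is connected
-- and has more than Δ + 1 vertices, no block is a clique, so the centre v of each
-- block has two nonadjacent neighbours x and y.  Exchanging the colours of v and x
-- keeps the colouring proper but spoils N[y].  A greedy choice finds such triples
-- in at least a third of the blocks, in an order in which each exchange leaves the
-- neighbourhoods of the earlier triples alone.  With k of them, undoing the
-- exchanges from N[y] shows that the 2 ^ k colourings obtained from the various
-- frozen colourings are all distinct.  So at most a fraction (1/2) ^ k of the
-- colourings is frozen, where n ≤ 3 k (Δ + 1), and 1/2 ≤ (6/7) ^ 3.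

module Submission where

open import Defs
open import Algebra.Bundles using (module CommutativeRing)
import Algebra.Definitions.RawSemiring as RawSemiring
import Algebra.Properties.Semiring.Exp as Exp
open import Data.Fin using (Fin; zero; suc; combine; finToFun; funToFin)
import Data.Fin.Properties as Fin
open import Data.Fin.Permutation.Components using (transpose; transpose-inverse)
open import Data.Integer as ℤ using (+_; +≤+)
import Data.Integer.Properties as ℤ
open import Data.List using (List; []; _∷_; _++_; length; map; filter; allFin; concatMap)
open import Data.List.Extrema.Nat using (xs≤max)
import Data.List.Membership.DecPropositional as DecMembership
open import Data.List.Membership.Propositional using (_∈_; _∉_; find)
open import Data.List.Membership.Propositional.Properties
  using (∈-∃++; ∈-++⁻; ∈-++⁺ˡ; ∈-++⁺ʳ; ∈-allFin; ∈-filter⁺; ∈-filter⁻;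
         ∈-map⁺; ∈-map⁻; ∈-concatMap⁺; ∈-length)
open import Data.List.Properties using (length-++; length-map; length-tabulate; filter-notAll)
open import Data.List.Relation.Binary.Permutation.Propositional using (↭-sym; ↭⇒↭ₛ)
open import Data.List.Relation.Binary.Permutation.Propositional.Properties
  using (↭-length; ∈-resp-↭)
import Data.List.Relation.Binary.Permutation.Setoid.Properties as Permutation
open import Data.List.Relation.Unary.All as All using (All; []; _∷_)
import Data.List.Relation.Unary.All.Properties as All
open import Data.List.Relation.Unary.AllPairs as AllPairs using (AllPairs; []; _∷_)
import Data.List.Relation.Unary.AllPairs.Properties as AllPairs
open import Data.List.Relation.Unary.Any as Any using (here; there)
import Data.List.Relation.Unary.Linked.Properties as Linked
open import Data.List.Relation.Unary.Unique.Propositional using (Unique)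
open import Data.List.Relation.Unary.Unique.Propositional.Properties
  using (allFin⁺; filter⁺; map⁺; ++⁺)
import Data.List.Sort as Sort
open import Data.Nat as ℕ using (ℕ; zero; suc; _+_; _*_; _∸_; _^_; _≤_; z≤n; s≤s)
import Data.Nat.Properties as ℕ
open import Data.Nat.Tactic.RingSolver using (solve-∀)
open import Data.Product using (∃; _×_; _,_; proj₁; proj₂)
open import Data.Rational as ℚ using (ℚ; _/_; 0ℚ; 1ℚ; ½)
import Data.Rational.Properties as ℚ
open import Data.Rational.Unnormalised as ℚᵘ using (mkℚᵘ; *≡*; *≤*)
import Data.Rational.Unnormalised.Properties as ℚᵘ
open import Data.Sum using (_⊎_; inj₁; inj₂; [_,_]′)
open import Function using (_∘_; id)
open import Level using (0ℓ)
open import Relation.Binary.Construct.Closure.ReflexiveTransitive using (Star; ε; _◅_)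
import Relation.Binary.Construct.On as On
open import Relation.Binary.Definitions using (DecidableEquality)
open import Relation.Binary.PropositionalEquality
open import Relation.Nullary using (¬_; ¬?; Dec; yes; no; contradiction)
open import Relation.Nullary.Decidable
  using (_→-dec_; _×-dec_; _⊎-dec_; dec-true; dec-false; from-yes)
open import Relation.Unary using (Pred; Decidable)

-- Counting with duplicate-free lists.

module _ {A : Set} where

  -- The entries of `xs` are struck from `ys` one by one; as `xs` has no repetitions, each strike
  -- finds a copy still present. Besides comparing lengths, this charges killed vertices to a lost
  -- block.
  remove-⊆ : {xs ys : List A} → Unique xs → (∀ {z} → z ∈ xs → z ∈ ys) →
    ∃ λ zs → length xs + length zs ≡ length ys × (∀ {z} → z ∈ ys → z ∉ xs → z ∈ zs)
  remove-⊆ {[]} {ys} _ _ = ys , refl , λ z∈ _ → z∈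
  remove-⊆ {x ∷ xs} (x∉ ∷ u) sub with ∈-∃++ (sub (here refl))
  ... | ps , qs , refl with remove-⊆ {ys = ps ++ qs} u sub′
    where
    sub′ : ∀ {z} → z ∈ xs → z ∈ ps ++ qs
    sub′ z∈ with ∈-++⁻ ps (sub (there z∈))
    ... | inj₁ p           = ∈-++⁺ˡ p
    ... | inj₂ (here refl) = contradiction refl (All.lookup x∉ z∈)
    ... | inj₂ (there q)   = ∈-++⁺ʳ ps q
  ... | zs , len , rest = zs , len′ , rest′
    where
    len′ : suc (length xs + length zs) ≡ length (ps ++ x ∷ qs)
    len′ = begin
      suc (length xs + length zs)  ≡⟨ cong suc len ⟩
      suc (length (ps ++ qs))      ≡⟨ cong suc (length-++ ps) ⟩
      suc (length ps + length qs)  ≡⟨ ℕ.+-suc (length ps) (length qs) ⟨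
      length ps + suc (length qs)  ≡⟨ length-++ ps ⟨
      length (ps ++ x ∷ qs)        ∎
      where open ≡-Reasoning
    rest′ : ∀ {z} → z ∈ ps ++ x ∷ qs → z ∉ x ∷ xs → z ∈ zs
    rest′ z∈ z∉ with ∈-++⁻ ps z∈
    ... | inj₁ p          = rest (∈-++⁺ˡ p) (z∉ ∘ there)
    ... | inj₂ (here z≡x) = contradiction (here z≡x) z∉
    ... | inj₂ (there q)  = rest (∈-++⁺ʳ ps q) (z∉ ∘ there)

  unique-⊆⇒length-≤ : {xs ys : List A} → Unique xs → (∀ {z} → z ∈ xs → z ∈ ys) →
    length xs ≤ length ys
  unique-⊆⇒length-≤ u sub with remove-⊆ u sub
  ... | _ , len , _ = ℕ.≤-trans (ℕ.m≤m+n _ _) (ℕ.≤-reflexive len)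

  length-filter-filter-map : {B : Set} {P Q : Pred B 0ℓ} (P? : Decidable P) (Q? : Decidable Q)
    {R : Pred A 0ℓ} (R? : Decidable R) (f : A → B) →
    (∀ x → Q (f x) → P (f x) → R x) → ∀ xs →
    length (filter P? (filter Q? (map f xs))) ≤ length (filter R? xs)
  length-filter-filter-map P? Q? R? f imp [] = z≤n
  length-filter-filter-map P? Q? R? f imp (x ∷ xs)
    with ih ← length-filter-filter-map P? Q? R? f imp xs | Q? (f x)
  ... | no _ with R? x
  ...   | yes _ = ℕ.m≤n⇒m≤1+n ih
  ...   | no  _ = ih
  length-filter-filter-map P? Q? R? f imp (x ∷ xs) | yes q with P? (f x) | R? x
  ...   | yes p | yes _ = s≤s ih
  ...   | yes p | no ¬r = contradiction (imp x q p) ¬r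
  ...   | no  _ | yes _ = ℕ.m≤n⇒m≤1+n ih
  ...   | no  _ | no  _ = ih

  length-filter-map : {B : Set} {P : Pred A 0ℓ} (P? : Decidable P) {Q : Pred B 0ℓ}
    (Q? : Decidable Q) (f : A → B) → (∀ x → P x → Q (f x)) → ∀ xs →
    length (filter P? xs) ≤ length (filter Q? (map f xs))
  length-filter-map P? Q? f imp [] = z≤n
  length-filter-map P? Q? f imp (x ∷ xs)
    with ih ← length-filter-map P? Q? f imp xs | P? x | Q? (f x)
  ... | yes _ | yes _ = s≤s ih
  ... | yes p | no ¬q = contradiction (imp x p) ¬q
  ... | no  _ | yes _ = ℕ.m≤n⇒m≤1+n ih
  ... | no  _ | no  _ = ih

-- Greedy choice of sites in an abstract setting.

Avoiding : {A B Site : Set} → (Site → A) → (Site → B) → (Site → List B) → Site → Site → Set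
Avoiding block vertex kill t s = block t ≢ block s × vertex t ∉ kill s

-- `A` and `B` stand for centres and vertices, `X a` for the movable vertices around the centre `a`,
-- and `kill s` for the vertices that must not be the `vertex` of a later pick.
module _ {A B Site : Set} (_≟_ : DecidableEquality B) (C : Pred A 0ℓ)
  (X : A → List B) (X! : ∀ a → Unique (X a))
  (X# : ∀ {a b} → C a → C b → a ≢ b → ∀ {x} → x ∈ X a → x ∉ X b)
  (block : Site → A) (vertex : Site → B) (kill : Site → List B)
  (sites : ∀ {a} → C a → ∀ {x} → x ∈ X a → ∃ λ s →
     block s ≡ a × vertex s ≡ x × length (kill s) + 2 ≤ 2 * length (X a))
  where

  open DecMembership _≟_ using (_∈?_)

  private
    -- If `a` is `b + d`, then `r * d ≤ k`, hence `q * d ≤ k`. This lets `greedy` recurse with the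
    -- size of the current block as weight and then return to the smaller weight `q`.
    scale : ∀ {q r} a b k → q ≤ r → r * a ≤ r * b + k → q * a ≤ q * b + k
    scale {q} {r} a b k q≤r h with ℕ.≤-total a b
    ... | inj₁ a≤b = ℕ.≤-trans (ℕ.*-monoʳ-≤ q a≤b) (ℕ.m≤m+n _ k)
    ... | inj₂ b≤a with ℕ.m≤n⇒∃[o]m+o≡n b≤a
    ...   | d , refl = begin
      q * (b + d)    ≡⟨ ℕ.*-distribˡ-+ q b d ⟩
      q * b + q * d  ≤⟨ ℕ.+-monoʳ-≤ (q * b) (ℕ.*-monoˡ-≤ d q≤r) ⟩
      q * b + r * d  ≤⟨ ℕ.+-monoʳ-≤ (q * b) (ℕ.+-cancelˡ-≤ (r * b) _ _
                          (ℕ.≤-trans (ℕ.≤-reflexive (sym (ℕ.*-distribˡ-+ r b d))) h)) ⟩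
      q * b + k      ∎
      where open ℕ.≤-Reasoning

    -- A pick is worth `3 * r`: one `r` pays for its own block, the other two cover the `c` vertices
    -- it kills.
    pick-≤ : ∀ r l j c k → c + 2 ≤ 2 * r → ∀ j* →
      r * (l + 3 * suc j) ≤ r * (3 * j*) + (c + k) → r * (suc l + 3 * j) ≤ r * (3 * j*) + k
    pick-≤ r l j c k c≤ j* h = ℕ.+-cancelʳ-≤ (2 * r) _ _ (begin
      r * (suc l + 3 * j) + 2 * r    ≡⟨ e₁ r l j ⟩
      r * (l + 3 * suc j)            ≤⟨ h ⟩
      r * (3 * j*) + (c + k)         ≤⟨ ℕ.+-monoʳ-≤ (r * (3 * j*))
                                          (ℕ.+-monoˡ-≤ k (ℕ.≤-trans (ℕ.m≤m+n c 2) c≤)) ⟩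
      r * (3 * j*) + (2 * r + k)     ≡⟨ e₂ (r * (3 * j*)) (2 * r) k ⟩
      r * (3 * j*) + k + 2 * r       ∎)
      where
      open ℕ.≤-Reasoning
      e₁ : ∀ r l j → r * (suc l + 3 * j) + 2 * r ≡ r * (l + 3 * suc j)
      e₁ = solve-∀
      e₂ : ∀ a b k → a + (b + k) ≡ a + k + b
      e₂ = solve-∀

    -- A lost block costs `r`, paid by the `r` killed vertices that are struck from the list.
    skip-≤ : ∀ r l j k m → ∀ j* → r + k ≡ m →
      r * (l + 3 * j) ≤ r * (3 * j*) + k → r * (suc l + 3 * j) ≤ r * (3 * j*) + m
    skip-≤ r l j k _ j* refl h = begin
      r * (suc l + 3 * j)       ≡⟨ e₁ r l j ⟩
      r + r * (l + 3 * j)       ≤⟨ ℕ.+-monoʳ-≤ r h ⟩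
      r + (r * (3 * j*) + k)    ≡⟨ e₂ (r * (3 * j*)) r k ⟩
      r * (3 * j*) + (r + k)    ∎
      where
      open ℕ.≤-Reasoning
      e₁ : ∀ r l j → r * (suc l + 3 * j) ≡ r + r * (l + 3 * j)
      e₁ = solve-∀
      e₂ : ∀ a b k → b + (a + k) ≡ a + (b + k)
      e₂ = solve-∀

  -- The blocks are visited in order of increasing size |X b|.  A pick kills fewer
  -- than 2 |X b| vertices, and a block is lost only once all of its vertices, at
  -- least as many as in any earlier block, are killed; so the lost blocks number
  -- at most twice the picks.  K lists the killed vertices not yet charged to a
  -- lost block; J lists the picks, the latest first.
  greedy : ∀ (L : List A) (K : List B) (J : List Site) q → All C L →
    AllPairs (λ a b → length (X a) ≤ length (X b)) L →
    Unique L →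
    All (λ b → q ≤ length (X b)) L →
    (∀ {b} → b ∈ L → ∀ {x} → x ∈ X b → x ∉ K → All (λ s → b ≢ block s × x ∉ kill s) J) →
    AllPairs (Avoiding block vertex kill) J →
    ∃ λ J* → AllPairs (Avoiding block vertex kill) J* ×
      q * (length L + 3 * length J) ≤ q * (3 * length J*) + length K
  greedy [] K J q _ _ _ _ _ J! = J , J! , ℕ.m≤m+n _ _
  greedy (b ∷ L) K J q (cb ∷ cs) (b≤ ∷ sorted) (b∉ ∷ L!) (q≤ ∷ _) free J!
    with All.all? (_∈? K) (X b)
  ... | yes Xb⊆K with remove-⊆ (X! b) (All.lookup Xb⊆K)
  ...   | K′ , len , rest with greedy L K′ J (length (X b)) cs sorted L! b≤ free′ J!
    where
    free′ : ∀ {c} → c ∈ L → ∀ {x} → x ∈ X c → x ∉ K′ → All (λ s → c ≢ block s × x ∉ kill s) J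
    -- Striking `X b` from `K` forgets no killed vertex of a later block, since the blocks are
    -- disjoint.
    free′ c∈ x∈ x∉ = free (there c∈) x∈ λ x∈K →
      x∉ (rest x∈K λ x∈Xb → X# cb (All.lookup cs c∈) (All.lookup b∉ c∈) x∈Xb x∈)
  ...   | J* , J*! , bound = J* , J*! ,
    scale _ _ _ q≤ (skip-≤ (length (X b)) (length L) (length J) _ _ (length J*) len bound)
  greedy (b ∷ L) K J q (cb ∷ cs) (b≤ ∷ sorted) (b∉ ∷ L!) (q≤ ∷ _) free J!
      | no ¬Xb⊆K with find (All.¬All⇒Any¬ (_∈? K) (X b) ¬Xb⊆K)
  ...   | x , x∈ , x∉ with sites cb x∈
  ...     | s , refl , refl , c≤ with greedy L (kill s ++ K) (s ∷ J) (length (X b)) cs sorted L! b≤ free′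
                                   (free (here refl) x∈ x∉ ∷ J!)
    where
    free′ : ∀ {c} → c ∈ L → ∀ {x} → x ∈ X c → x ∉ kill s ++ K →
      All (λ s → c ≢ block s × x ∉ kill s) (s ∷ J)
    free′ c∈ x∈ x∉ = (≢-sym (All.lookup b∉ c∈) , x∉ ∘ ∈-++⁺ˡ)
      ∷ free (there c∈) x∈ (x∉ ∘ ∈-++⁺ʳ (kill s))
  ...     | J* , J*! , bound = J* , J*! , scale _ _ _ q≤
    (pick-≤ (length (X b)) (length L) (length J) (length (kill s)) (length K) c≤ (length J*)
      (subst (λ k → _ ≤ _ + k) (length-++ (kill s)) bound))

-- Counting functions through their codes.

funToFin-cong : ∀ {m n} {f g : Fin m → Fin n} → f ≗ g → funToFin f ≡ funToFin g
funToFin-cong {zero}  f≗g = refl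
funToFin-cong {suc m} f≗g = cong₂ combine (f≗g zero) (funToFin-cong (f≗g ∘ suc))

module _ {n k : ℕ} where

  private
    decode : Fin (k ^ n) → Fin n → Fin k
    decode = finToFun

  -- Works on codes, where propositional equality amounts to pointwise equality of the coded
  -- functions.
  count : {P : Pred (Fin n → Fin k) 0ℓ} → Decidable P → ℕ
  count P? = length (filter (P? ∘ decode) (allFin (k ^ n)))

  -- The codes satisfying `P` and their images under the exchange of `i` and `j` are two disjoint
  -- sets of equal size inside `Q`. The closure under `≗` is there because `decode (swap a)` matches
  -- the composite it encodes only pointwise.
  count-double : {P Q : Pred (Fin n → Fin k) 0ℓ} (P? : Decidable P) (Q? : Decidable Q)
    (i j : Fin n) →
    (∀ {γ δ} → γ ≗ δ → P γ → P δ) → (∀ {γ δ} → γ ≗ δ → Q γ → Q δ) →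
    (∀ {γ} → P γ → Q γ) → (∀ {γ} → P γ → Q (γ ∘ transpose i j)) →
    (∀ {γ} → P γ → ¬ P (γ ∘ transpose i j)) →
    2 * count P? ≤ count Q?
  count-double {P} {Q} P? Q? i j P-resp Q-resp P⇒Q P⇒Q′ P⇒¬P′ = let open ℕ.≤-Reasoning in begin
    2 * length ps                      ≡⟨ cong (length ps ℕ.+_) (ℕ.+-identityʳ (length ps)) ⟩
    length ps + length ps              ≡⟨ cong (length ps ℕ.+_) (length-map swap ps) ⟨
    length ps + length (map swap ps)   ≡⟨ length-++ ps ⟨
    length (ps ++ map swap ps)         ≤⟨ unique-⊆⇒length-≤ (++⁺ ps! (map⁺ swap-inj ps!) disj) sub ⟩
    count Q?                           ∎
    where
    codes = allFin (k ^ n)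
    ps = filter (P? ∘ decode) codes
    ps! : Unique ps
    ps! = filter⁺ (P? ∘ decode) (allFin⁺ (k ^ n))
    swap : Fin (k ^ n) → Fin (k ^ n)
    swap a = funToFin (decode a ∘ transpose i j)
    swap-≗ : ∀ a → decode (swap a) ≗ decode a ∘ transpose i j
    swap-≗ a = Fin.finToFun-funToFin (decode a ∘ transpose i j)
    swap-inj : ∀ {a b} → swap a ≡ swap b → a ≡ b
    swap-inj {a} {b} e = trans (sym (Fin.funToFin-finToFin {n} {k} a))
      (trans (funToFin-cong eq) (Fin.funToFin-finToFin {n} {k} b))
      where
      eq : decode a ≗ decode b
      eq c = let open ≡-Reasoning in begin
        decode a c                                   ≡⟨ cong (decode a) (transpose-inverse i j) ⟨
        decode a (transpose i j (transpose j i c))   ≡⟨ swap-≗ a _ ⟨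
        decode (swap a) (transpose j i c)            ≡⟨ cong (λ z → decode z (transpose j i c)) e ⟩
        decode (swap b) (transpose j i c)            ≡⟨ swap-≗ b _ ⟩
        decode b (transpose i j (transpose j i c))   ≡⟨ cong (decode b) (transpose-inverse i j) ⟩
        decode b c                                   ∎
    P-of : ∀ {a} → a ∈ ps → P (decode a)
    P-of a∈ = proj₂ (∈-filter⁻ (P? ∘ decode) {xs = codes} a∈)
    disj : ∀ {a} → ¬ (a ∈ ps × a ∈ map swap ps)
    disj (a∈ , a∈′) with ∈-map⁻ swap a∈′
    ... | b , b∈ , refl = P⇒¬P′ (P-of b∈) (P-resp (swap-≗ b) (P-of a∈))
    sub : ∀ {a} → a ∈ ps ++ map swap ps → a ∈ filter (Q? ∘ decode) codes
    sub a∈ with ∈-++⁻ ps a∈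
    ... | inj₁ p = ∈-filter⁺ (Q? ∘ decode) (∈-allFin _) (P⇒Q (P-of p))
    ... | inj₂ p with ∈-map⁻ swap p
    ...   | b , b∈ , refl = ∈-filter⁺ (Q? ∘ decode) (∈-allFin _)
      (Q-resp (sym ∘ swap-≗ b) (P⇒Q′ (P-of b∈)))

module _ {n : ℕ} where

  transpose-left : (i j : Fin n) → transpose i j i ≡ j
  transpose-left i j rewrite dec-true (i Fin.≟ i) refl = refl

  transpose-right : (i j : Fin n) → transpose i j j ≡ i
  transpose-right i j with j Fin.≟ i
  ... | yes j≡i = j≡i
  ... | no  _ rewrite dec-true (j Fin.≟ j) refl = refl

  transpose-other : {i j a : Fin n} → a ≢ i → a ≢ j → transpose i j a ≡ a
  transpose-other {i} {j} {a} a≢i a≢j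
    rewrite dec-false (a Fin.≟ i) a≢i | dec-false (a Fin.≟ j) a≢j = refl

-- Kempe changes at sites.

module _ {n : ℕ} (G : Graph n) where
  open Graph G

  record Site : Set where
    field
      v x y : Fin n
      v~x   : v ~ x
      v~y   : v ~ y
      x≢y   : x ≢ y
      x≁y   : ¬ x ~ y

    Near : Fin n → Set
    Near z = _∈N[_] G z v ⊎ _∈N[_] G z x ⊎ _∈N[_] G z y

  open Site

  -- Exchanging the colours of v and x is a Kempe change; it changes the colour
  -- of v but of nothing else in N[y], where the old colour of v then is missing.
  Swappable : {k : ℕ} → Site → Pred (Fin n → Fin k) 0ℓ
  Swappable s γ =
    (∀ b → v s ~ b → b ≢ x s → γ b ≢ γ (x s)) ×
    (∀ b → x s ~ b → b ≢ v s → γ b ≢ γ (v s)) ×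
    (∀ b → _∈N[_] G b (y s) → b ≢ v s → γ b ≢ γ (v s)) ×
    (∃ λ b → _∈N[_] G b (y s) × b ≢ v s × γ b ≡ γ (x s))

  swappable? : {k : ℕ} (s : Site) → Decidable (Swappable {k} s)
  swappable? s γ =
    Fin.all? (λ b → (v s ~? b) →-dec ¬? (b Fin.≟ x s) →-dec ¬? (γ b Fin.≟ γ (x s))) ×-dec
    Fin.all? (λ b → (x s ~? b) →-dec ¬? (b Fin.≟ v s) →-dec ¬? (γ b Fin.≟ γ (v s))) ×-dec
    Fin.all? (λ b → near? b →-dec ¬? (b Fin.≟ v s) →-dec ¬? (γ b Fin.≟ γ (v s))) ×-dec
    Fin.any? (λ b → near? b ×-dec ¬? (b Fin.≟ v s) ×-dec (γ b Fin.≟ γ (x s)))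
    where
    near? : Decidable (λ b → _∈N[_] G b (y s))
    near? b = b Fin.≟ y s ⊎-dec y s ~? b

  -- Not symmetric: the swap at s may well affect the vertices near t.
  Untouched : Site → Site → Set
  Untouched t s = ¬ Near s (v t) × ¬ Near s (x t)

  module _ {k : ℕ} where

    -- `Near s` contains every vertex whose colour `Swappable s` compares, so the condition is
    -- local.
    swappable-cong : ∀ s {γ δ : Fin n → Fin k} → (∀ z → Near s z → γ z ≡ δ z) →
      Swappable s γ → Swappable s δ
    swappable-cong s {γ} {δ} eq (at-v , at-x , at-y , b , b∈ , b≢v , γb≡γx) =
      (λ b v~b b≢x → transfer (inj₁ (inj₂ v~b)) nx (at-v b v~b b≢x)) ,
      (λ b x~b b≢v → transfer (inj₂ (inj₁ (inj₂ x~b))) nv (at-x b x~b b≢v)) ,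
      (λ b b∈ b≢v → transfer (inj₂ (inj₂ b∈)) nv (at-y b b∈ b≢v)) ,
      b , b∈ , b≢v , trans (sym (eq b (inj₂ (inj₂ b∈)))) (trans γb≡γx (eq (x s) nx))
      where
      nv : Near s (v s)
      nv = inj₁ (inj₁ refl)
      nx : Near s (x s)
      nx = inj₁ (inj₂ (v~x s))
      transfer : ∀ {a b} → Near s a → Near s b → γ a ≢ γ b → δ a ≢ δ b
      transfer na nb ne e = ne (trans (eq _ na) (trans e (sym (eq _ nb))))

    swapped : Site → (Fin n → Fin k) → Fin n → Fin k
    swapped s γ = γ ∘ transpose (v s) (x s)

    swapped-v : ∀ s γ → swapped s γ (v s) ≡ γ (x s)
    swapped-v s γ = cong γ (transpose-left (v s) (x s))

    swapped-x : ∀ s γ → swapped s γ (x s) ≡ γ (v s)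
    swapped-x s γ = cong γ (transpose-right (v s) (x s))

    swapped-other : ∀ s γ {a} → a ≢ v s → a ≢ x s → swapped s γ a ≡ γ a
    swapped-other s γ a≢v a≢x = cong γ (transpose-other a≢v a≢x)

    -- Only edges at `v s` or `x s` are affected. The first two clauses of `Swappable` keep the new
    -- colour of either end off its other neighbours, and the edge between them merely has its
    -- colours exchanged.
    swapped-proper : ∀ s {γ} → Proper G γ → Swappable s γ → Proper G (swapped s γ)
    swapped-proper s {γ} proper (at-v , at-x , _) = ok
      where
      from-v : ∀ {b} → Dec (b ≡ x s) → v s ~ b → swapped s γ (v s) ≢ swapped s γ b
      from-v (yes refl) v~b e = proper (x s) (v s) (~-sym v~b)
        (trans (sym (swapped-v s γ)) (trans e (swapped-x s γ)))
      from-v (no b≢x) v~b e = at-v _ v~b b≢x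
        (trans (sym (swapped-other s γ (λ b≡v → ~-irrefl (sym b≡v) v~b) b≢x))
          (trans (sym e) (swapped-v s γ)))
      from-x : ∀ {b} → Dec (b ≡ v s) → x s ~ b → swapped s γ (x s) ≢ swapped s γ b
      from-x (yes refl) _ e = from-v (x s Fin.≟ x s) (v~x s) (sym e)
      from-x (no b≢v) x~b e = at-x _ x~b b≢v
        (trans (sym (swapped-other s γ b≢v (λ b≡x → ~-irrefl (sym b≡x) x~b)))
          (trans (sym e) (swapped-x s γ)))
      from-any : ∀ {a b} → Dec (a ≡ v s) → Dec (a ≡ x s) → Dec (b ≡ v s) → Dec (b ≡ x s) →
        a ~ b → swapped s γ a ≢ swapped s γ b
      from-any (yes refl) _ _ b≟x a~b = from-v b≟x a~b
      from-any _ (yes refl) b≟v _ a~b = from-x b≟v a~b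
      from-any _ a≟x (yes refl) _ a~b = from-v a≟x (~-sym a~b) ∘ sym
      from-any a≟v _ _ (yes refl) a~b = from-x a≟v (~-sym a~b) ∘ sym
      from-any (no a≢v) (no a≢x) (no b≢v) (no b≢x) a~b e = proper _ _ a~b
        (trans (sym (swapped-other s γ a≢v a≢x)) (trans e (swapped-other s γ b≢v b≢x)))
      ok : Proper G (swapped s γ)
      ok a b = from-any (a Fin.≟ v s) (a Fin.≟ x s) (b Fin.≟ v s) (b Fin.≟ x s)

    -- The witness `b` in `N[y]` with the colour of `x` is not `x`, as `x` and `y` are distinct and
    -- nonadjacent, so it keeps its colour. After the swap `v` has this colour too, against the
    -- third clause. Thus `Swappable s` tells a colouring from its swap.
    swapped-¬swappable : ∀ s {γ} → Swappable s γ → ¬ Swappable s (swapped s γ)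
    swapped-¬swappable s {γ} (_ , _ , _ , b , b∈ , b≢v , γb≡γx) (_ , _ , at-y , _) =
      at-y b b∈ b≢v (trans (swapped-other s γ b≢v b≢x) (trans γb≡γx (sym (swapped-v s γ))))
      where
      b≢x : b ≢ x s
      b≢x e = [ (λ b≡y → x≢y s (trans (sym e) b≡y))
              , (λ y~b → x≁y s (~-sym (subst (y s ~_) e y~b))) ]′ b∈

    swapped-swappable : ∀ {s t γ} → Untouched t s → Swappable s γ → Swappable s (swapped t γ)
    swapped-swappable {s} {t} {γ} (¬v , ¬x) = swappable-cong s λ z near →
      sym (swapped-other t γ (λ { refl → ¬v near }) (λ { refl → ¬x near }))

    -- Replaces frozenness in the induction: a swap at one site destroys frozenness but can leave
    -- the conditions at other sites intact.
    Good : List Site → Pred (Fin n → Fin k) 0ℓ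
    Good J γ = Proper G γ × All (λ s → Swappable s γ) J

    good? : ∀ J → Decidable (Good J)
    good? J γ = proper? G γ ×-dec All.all? (λ s → swappable? s γ) J

    good-resp : ∀ J {γ δ} → γ ≗ δ → Good J γ → Good J δ
    good-resp J eq (proper , sw) =
      (λ a b a~b e → proper a b a~b (trans (eq a) (trans e (sym (eq b))))) ,
      All.map (λ {s} → swappable-cong s λ z _ → eq z) sw

    -- Dropping the head `t` at least doubles the count: the swap at `t` disturbs no site of `J`,
    -- and `Swappable t` separates the two colourings. The order matters, as `Untouched` runs only
    -- from head to tail.
    count-good : ∀ J → AllPairs Untouched J → 2 ^ length J * count (good? J) ≤ count (good? [])
    count-good [] _ = ℕ.≤-reflexive (ℕ.+-identityʳ _)
    count-good (t ∷ J) (un ∷ J!) = begin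
      2 * 2 ^ length J * count (good? (t ∷ J))    ≡⟨ e (2 ^ length J) (count (good? (t ∷ J))) ⟩
      2 ^ length J * (2 * count (good? (t ∷ J)))  ≤⟨ ℕ.*-monoʳ-≤ (2 ^ length J) double ⟩
      2 ^ length J * count (good? J)              ≤⟨ count-good J J! ⟩
      count (good? [])                            ∎
      where
      open ℕ.≤-Reasoning
      e : ∀ a b → 2 * a * b ≡ a * (2 * b)
      e = solve-∀
      double : 2 * count (good? (t ∷ J)) ≤ count (good? J)
      double = count-double (good? (t ∷ J)) (good? J) (v t) (x t)
        (good-resp (t ∷ J)) (good-resp J)
        (λ { (proper , _ ∷ sw) → proper , sw })
        (λ { (proper , sw-t ∷ sw) → swapped-proper t proper sw-t ,
               All.zipWith (λ { {s} (u , sw-s) → swapped-swappable {s} {t} u sw-s }) (un , sw) })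
        (λ { (_ , sw-t ∷ _) (_ , sw-t′ ∷ _) → swapped-¬swappable t sw-t sw-t′ })

-- Exits, nonneighbours and movable vertices.

module _ {n : ℕ} (G : Graph n) where
  open Graph G

  ∈-neighbours⁺ : ∀ {v u} → v ~ u → u ∈ neighbours G v
  ∈-neighbours⁺ {v} v~u = ∈-filter⁺ (v ~?_) (∈-allFin _) v~u

  ∈-neighbours⁻ : ∀ {v u} → u ∈ neighbours G v → v ~ u
  ∈-neighbours⁻ {v} u∈ = proj₂ (∈-filter⁻ (v ~?_) {xs = allFin n} u∈)

  neighbours! : ∀ v → Unique (neighbours G v)
  neighbours! v = filter⁺ (v ~?_) (allFin⁺ n)

  closed : Fin n → List (Fin n)
  closed v = v ∷ neighbours G v

  ∈-closed⁺ : ∀ {v u} → _∈N[_] G u v → u ∈ closed v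
  ∈-closed⁺ (inj₁ u≡v) = here u≡v
  ∈-closed⁺ (inj₂ v~u) = there (∈-neighbours⁺ v~u)

  ∈N-sym : ∀ {u v} → _∈N[_] G u v → _∈N[_] G v u
  ∈N-sym (inj₁ u≡v) = inj₁ (sym u≡v)
  ∈N-sym (inj₂ v~u) = inj₂ (~-sym v~u)

  degree≤maxDegree : ∀ v → degree G v ≤ maxDegree G
  degree≤maxDegree v =
    All.lookup (xs≤max 0 (map (degree G) (allFin n))) (∈-map⁺ (degree G) (∈-allFin v))

  nonNeighbour? : ∀ v x → Decidable (λ y → v ~ y × x ≢ y × ¬ x ~ y)
  nonNeighbour? v x y = (v ~? y) ×-dec ¬? (x Fin.≟ y) ×-dec ¬? (x ~? y)

  nonNeighbours : Fin n → Fin n → List (Fin n)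
  nonNeighbours v x = filter (nonNeighbour? v x) (allFin n)

  exit? : ∀ v x → Decidable (λ z → x ~ z × ¬ _∈N[_] G z v)
  exit? v x z = (x ~? z) ×-dec ¬? (z Fin.≟ v ⊎-dec v ~? z)

  exits : Fin n → Fin n → List (Fin n)
  exits v x = filter (exit? v x) (allFin n)

  common? : ∀ v x → Decidable (λ z → v ~ z × x ~ z)
  common? v x z = (v ~? z) ×-dec (x ~? z)

  movable? : ∀ v → Decidable (λ x → v ~ x × ∃ λ y → v ~ y × x ≢ y × ¬ x ~ y)
  movable? v x = (v ~? x) ×-dec Fin.any? (nonNeighbour? v x)

  movables : Fin n → List (Fin n)
  movables v = filter (movable? v) (allFin n)

  private
    ∈-filter-allFin⁻ : {P : Pred (Fin n) 0ℓ} (P? : Decidable P) → ∀ {u} →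
      u ∈ filter P? (allFin n) → P u
    ∈-filter-allFin⁻ P? u∈ = proj₂ (∈-filter⁻ P? {xs = allFin n} u∈)

    ∈-filter-allFin⁺ : {P : Pred (Fin n) 0ℓ} (P? : Decidable P) → ∀ {u} →
      P u → u ∈ filter P? (allFin n)
    ∈-filter-allFin⁺ P? p = ∈-filter⁺ P? (∈-allFin _) p

    filter! : {P : Pred (Fin n) 0ℓ} (P? : Decidable P) → Unique (filter P? (allFin n))
    filter! P? = filter⁺ P? (allFin⁺ n)

    ∷! : ∀ {x : Fin n} {xs} → x ∉ xs → Unique xs → Unique (x ∷ xs)
    ∷! x∉ xs! = All.tabulate (λ y∈ e → x∉ (subst (_∈ _) (sym e) y∈)) ∷ xs!

  -- If `v` and `x` have `c` common neighbours, then `N(x)` holds `v`, these `c` and the exits,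
  -- while `N(v)` is covered by `x`, these `c` and the nonneighbours. Comparing degrees cancels
  -- `1 + c`.
  length-exits-≤ : ∀ {v x} → v ~ x → degree G x ≤ degree G v →
    length (exits v x) ≤ length (nonNeighbours v x)
  length-exits-≤ {v} {x} v~x deg = ℕ.+-cancelˡ-≤ (length common) _ _ (ℕ.s≤s⁻¹ (begin
    suc (length common + length (exits v x))          ≡⟨ cong suc (length-++ common) ⟨
    suc (length (common ++ exits v x))                ≤⟨ unique-⊆⇒length-≤ left! left⊆ ⟩
    degree G x                                        ≤⟨ deg ⟩
    degree G v                                        ≤⟨ unique-⊆⇒length-≤ (neighbours! v) ⊆right ⟩
    suc (length (common ++ nonNeighbours v x))        ≡⟨ cong suc (length-++ common) ⟩
    suc (length common + length (nonNeighbours v x))  ∎))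
    where
    open ℕ.≤-Reasoning
    common = filter (common? v x) (allFin n)
    left! : Unique (v ∷ common ++ exits v x)
    left! = ∷! v∉ (++⁺ (filter! (common? v x)) (filter! (exit? v x)) disj)
      where
      v∉ : v ∉ common ++ exits v x
      v∉ v∈ with ∈-++⁻ common v∈
      ... | inj₁ p = ~-irrefl refl (proj₁ (∈-filter-allFin⁻ (common? v x) p))
      ... | inj₂ p = proj₂ (∈-filter-allFin⁻ (exit? v x) p) (inj₁ refl)
      disj : ∀ {u} → ¬ (u ∈ common × u ∈ exits v x)
      disj (p , q) = proj₂ (∈-filter-allFin⁻ (exit? v x) q)
        (inj₂ (proj₁ (∈-filter-allFin⁻ (common? v x) p)))
    left⊆ : ∀ {u} → u ∈ v ∷ common ++ exits v x → u ∈ neighbours G x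
    left⊆ (here refl) = ∈-neighbours⁺ (~-sym v~x)
    left⊆ (there u∈) with ∈-++⁻ common u∈
    ... | inj₁ p = ∈-neighbours⁺ (proj₂ (∈-filter-allFin⁻ (common? v x) p))
    ... | inj₂ p = ∈-neighbours⁺ (proj₁ (∈-filter-allFin⁻ (exit? v x) p))
    ⊆right : ∀ {u} → u ∈ neighbours G v → u ∈ x ∷ common ++ nonNeighbours v x
    ⊆right {u} u∈ with u Fin.≟ x | x ~? u
    ... | yes u≡x | _      = here u≡x
    ... | no _    | yes x~u = there (∈-++⁺ˡ (∈-filter-allFin⁺ (common? v x) (∈-neighbours⁻ u∈ , x~u)))
    ... | no u≢x  | no x≁u  = there (∈-++⁺ʳ common
      (∈-filter-allFin⁺ (nonNeighbour? v x) (∈-neighbours⁻ u∈ , ≢-sym u≢x , x≁u)))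

  -- Nonadjacency is symmetric, so the nonneighbours of `x` in `N(v)` are movable as well, and `x`
  -- itself is one more.
  length-nonNeighbours-< : ∀ {v x} → x ∈ movables v →
    length (nonNeighbours v x) ℕ.< length (movables v)
  length-nonNeighbours-< {v} {x} x∈ =
    unique-⊆⇒length-≤ (∷! x∉ (filter! (nonNeighbour? v x))) sub
    where
    x∉ : x ∉ nonNeighbours v x
    x∉ p = proj₁ (proj₂ (∈-filter-allFin⁻ (nonNeighbour? v x) p)) refl
    sub : ∀ {u} → u ∈ x ∷ nonNeighbours v x → u ∈ movables v
    sub (here refl) = x∈
    sub (there u∈) with v~u , x≢u , x≁u ← ∈-filter-allFin⁻ (nonNeighbour? v x) u∈ =
      ∈-filter-allFin⁺ (movable? v) (v~u , x ,
        proj₁ (∈-filter-allFin⁻ (movable? v) x∈) , ≢-sym x≢u , x≁u ∘ ~-sym)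

  -- With nothing movable, no neighbour of `v` has a nonneighbour in `N(v)`, so by `length-exits-≤`
  -- none has an exit. Then no walk leaves `N[v]`, and connectedness bounds `n` by
  -- `suc (maxDegree G)`.
  movables-nonempty : Connected G → suc (maxDegree G) ℕ.< n → ∀ v →
    (∀ x → degree G x ≤ degree G v) → 1 ≤ length (movables v)
  movables-nonempty conn Δ<n v deg with movables v in eq
  ... | _ ∷ _ = s≤s z≤n
  ... | [] = contradiction Δ<n (ℕ.≤⇒≯ (begin
    n                  ≡⟨ length-tabulate {n = n} id ⟨
    length (allFin n)  ≤⟨ unique-⊆⇒length-≤ (allFin⁺ n) (λ {u} _ → ∈-closed⁺ (all-near u)) ⟩
    suc (degree G v)   ≤⟨ s≤s (degree≤maxDegree v) ⟩
    suc (maxDegree G)  ∎))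
    where
    open ℕ.≤-Reasoning
    none : ∀ {x} → x ∉ movables v
    none x∈ with () ← subst (_ ∈_) eq x∈
    step : ∀ {u w} → _∈N[_] G u v → u ~ w → _∈N[_] G w v
    step (inj₁ refl) u~w = inj₂ u~w
    step {u} {w} (inj₂ v~u) u~w with w Fin.≟ v ⊎-dec v ~? w
    ... | yes w∈ = w∈
    ... | no w∉ with nonNeighbours v u in eq′ | length-exits-≤ v~u (deg u)
    ...   | y ∷ _ | _ = contradiction
      (∈-filter-allFin⁺ (movable? v) (v~u , y ,
        ∈-filter-allFin⁻ (nonNeighbour? v u) (subst (y ∈_) (sym eq′) (here refl))))
      none
    ...   | [] | ≤0 = contradiction
      (ℕ.≤-trans (∈-length (∈-filter-allFin⁺ (exit? v u) (u~w , w∉))) ≤0) λ ()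
    reach : ∀ {u w} → _∈N[_] G u v → Star _~_ u w → _∈N[_] G w v
    reach u∈ ε = u∈
    reach u∈ (u~w ◅ path) = reach (step u∈ u~w) path
    all-near : ∀ u → _∈N[_] G u v
    all-near u = reach (inj₁ refl) (conn v u)

  surjective⇒≤ : ∀ {k} (f : Fin n → Fin k) xs → (∀ c → ∃ λ u → u ∈ xs × f u ≡ c) → k ≤ length xs
  surjective⇒≤ {k} f xs sur = begin
    k                  ≡⟨ length-tabulate {n = k} id ⟨
    length (allFin k)  ≤⟨ unique-⊆⇒length-≤ (allFin⁺ k) (λ {c} _ → hit c) ⟩
    length (map f xs)  ≡⟨ length-map f xs ⟩
    length xs          ∎
    where
    open ℕ.≤-Reasoning
    hit : ∀ c → c ∈ map f xs
    hit c with u , u∈ , refl ← sur c = ∈-map⁺ f u∈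

  -- Closed neighbourhoods in a frozen colouring.

  module _ (α : Fin n → Fin (suc (maxDegree G))) (frozen : Frozen G α) where

    maxDegree≤degree : ∀ v → maxDegree G ≤ degree G v
    maxDegree≤degree v = ℕ.s≤s⁻¹ (surjective⇒≤ α (closed v) λ c →
      let u , u∈ , e = frozen v c in u , ∈-closed⁺ u∈ , e)

    degree-≤ : ∀ x v → degree G x ≤ degree G v
    degree-≤ x v = ℕ.≤-trans (degree≤maxDegree x) (maxDegree≤degree v)

    -- If `a` and `b` differed, deleting `b` from `N[v]` would leave all `suc (maxDegree G)` colours
    -- on at most `maxDegree G` vertices.
    rainbow : ∀ {v a b} → _∈N[_] G a v → _∈N[_] G b v → α a ≡ α b → a ≡ b
    rainbow {v} {a} {b} a∈ b∈ e with a Fin.≟ b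
    ... | yes a≡b = a≡b
    ... | no a≢b = contradiction (s≤s (degree≤maxDegree v)) (ℕ.<⇒≱ (ℕ.≤-<-trans
      (surjective⇒≤ α rest hit) (filter-notAll (λ u → ¬? (u Fin.≟ b)) (closed v)
        (Any.map (λ b≡u u≢b → u≢b (sym b≡u)) (∈-closed⁺ b∈)))))
      where
      rest = filter (λ u → ¬? (u Fin.≟ b)) (closed v)
      hit : ∀ c → ∃ λ u → u ∈ rest × α u ≡ c
      hit c with frozen v c
      ... | u , u∈ , αu≡c with u Fin.≟ b
      ...   | yes refl = a , ∈-filter⁺ (λ u → ¬? (u Fin.≟ b)) (∈-closed⁺ a∈) a≢b , trans e αu≡c
      ...   | no u≢b   = u , ∈-filter⁺ (λ u → ¬? (u Fin.≟ b)) (∈-closed⁺ u∈) u≢b , αu≡c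

-- Choosing sites from a frozen colouring.

module _ {n : ℕ} (G : Graph n) where
  open Graph G
  open Site

  module _ (α : Fin n → Fin (suc (maxDegree G))) (frozen : Frozen G α) (proper : Proper G α) where

    -- The first three clauses are `rainbow` at `v`, `x` and `y`. For the last, `N[y]` contains the
    -- colour of `x`, and properness on the edge from `v` to `x` excludes `v` as its bearer.
    frozen-swappable : ∀ s → Swappable G s α
    frozen-swappable s =
      (λ b v~b b≢x → b≢x ∘ rainbow G α frozen (inj₂ v~b) (inj₂ (v~x s))) ,
      (λ b x~b b≢v → b≢v ∘ rainbow G α frozen (inj₂ x~b) (inj₂ (~-sym (v~x s)))) ,
      (λ b b∈ b≢v → b≢v ∘ rainbow G α frozen b∈ (inj₂ (~-sym (v~y s)))) ,
      (let b , b∈ , αb≡αx = frozen (y s) (α (x s)) in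
        b , b∈ , (λ { refl → proper _ _ (v~x s) αb≡αx }) , αb≡αx)

  module _ (α : Fin n → Fin (suc (maxDegree G))) (frozen : Frozen G α) where

    Centre : Pred (Fin n) 0ℓ
    Centre v = α v ≡ zero

    CentredSite : Set
    CentredSite = ∃ λ (s : Site G) → Centre (v s)

    -- Both centres lie in `N[w]`, where colour `zero` occurs only once.
    blocks-disjoint : ∀ {u v w} → Centre u → Centre v → _∈N[_] G w u → _∈N[_] G w v → u ≡ v
    blocks-disjoint cu cv w∈u w∈v =
      rainbow G α frozen (∈N-sym G w∈u) (∈N-sym G w∈v) (trans cu (sym cv))

    killed : CentredSite → List (Fin n)
    killed (s , _) = exits G (v s) (x s) ++ exits G (v s) (y s)

    movable⇒N : ∀ {v x} → x ∈ movables G v → _∈N[_] G x v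
    movable⇒N {v} x∈ = inj₂ (proj₁ (proj₂ (∈-filter⁻ (movable? G v) {xs = allFin n} x∈)))

    -- Both `x₀` and a nonneighbour `y₀` of it are movable. Each has at most as many exits as
    -- nonneighbours, hence fewer than there are movable vertices; `+ 2` records the two strict
    -- inequalities.
    site-at : ∀ {a} → Centre a → ∀ {x₀} → x₀ ∈ movables G a → ∃ λ (s : CentredSite) →
      v (proj₁ s) ≡ a × x (proj₁ s) ≡ x₀ × length (killed s) + 2 ≤ 2 * length (movables G a)
    site-at {a} ca {x₀} x∈
      with _ , a~x , y₀ , a~y , x≢y , x≁y ← ∈-filter⁻ (movable? G a) {xs = allFin n} x∈ =
      (record { v~x = a~x ; v~y = a~y ; x≢y = x≢y ; x≁y = x≁y } , ca) , refl , refl , (begin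
        length (exits G a x₀ ++ exits G a y₀) + 2  ≡⟨ cong (_+ 2) (length-++ (exits G a x₀)) ⟩
        length (exits G a x₀) + length (exits G a y₀) + 2 ≡⟨ e (length (exits G a x₀)) _ ⟩
        suc (length (exits G a x₀)) + suc (length (exits G a y₀)) ≤⟨ ℕ.+-mono-≤ (few x∈ a~x) (few y∈ a~y) ⟩
        length (movables G a) + length (movables G a) ≡⟨ cong (length (movables G a) ℕ.+_) (ℕ.+-identityʳ _) ⟨
        2 * length (movables G a) ∎)
      where
      open ℕ.≤-Reasoning
      e : ∀ a b → a + b + 2 ≡ suc a + suc b
      e = solve-∀
      y∈ : y₀ ∈ movables G a
      y∈ = ∈-filter⁺ (movable? G a) (∈-allFin y₀) (a~y , x₀ , a~x , ≢-sym x≢y , x≁y ∘ ~-sym)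
      few : ∀ {u} → u ∈ movables G a → a ~ u →
        length (exits G a u) ℕ.< length (movables G a)
      few u∈ a~u = ℕ.≤-<-trans (length-exits-≤ G a~u (degree-≤ G α frozen _ a))
        (length-nonNeighbours-< G u∈)

    movables! : ∀ v → Unique (movables G v)
    movables! v = filter⁺ (movable? G v) (allFin⁺ n)

    movables# : ∀ {u v} → Centre u → Centre v → u ≢ v → ∀ {x} → x ∈ movables G u → x ∉ movables G v
    movables# cu cv u≢v x∈u x∈v = u≢v (blocks-disjoint cu cv (movable⇒N x∈u) (movable⇒N x∈v))

    Avoids : CentredSite → CentredSite → Set
    Avoids = Avoiding (v ∘ proj₁) (x ∘ proj₁) killed

    -- Disjointness of the blocks settles `N[v s]`. If `v t` were in `N[x s]` or `N[y s]`, then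
    -- `x s` or `y s` would lie in both blocks. The vertex `x t` could be there only as an exit, and
    -- the exits are killed.
    avoids⇒untouched : ∀ {t s} → Avoids t s → Untouched G (proj₁ t) (proj₁ s)
    avoids⇒untouched {t , ct} {s , cs} (vt≢vs , xt∉) = ¬v , ¬x
      where
      other-block : ∀ {z} → _∈N[_] G z (v t) → ¬ _∈N[_] G z (v s)
      other-block z∈t z∈s = vt≢vs (blocks-disjoint ct cs z∈t z∈s)
      not-at : ∀ {u} → v s ~ u → ¬ _∈N[_] G (v t) u
      not-at vs~u vt∈ = other-block (∈N-sym G vt∈) (inj₂ vs~u)
      exit : ∀ {u} → v s ~ u → _∈N[_] G (x t) u → x t ∈ exits G (v s) u
      exit vs~u (inj₁ refl) = contradiction (inj₂ vs~u) (other-block (inj₂ (v~x t)))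
      exit vs~u (inj₂ u~xt) = ∈-filter⁺ (exit? G (v s) _) (∈-allFin _)
        (u~xt , other-block (inj₂ (v~x t)))
      ¬v : ¬ Near s (v t)
      ¬v (inj₁ p)        = other-block (inj₁ refl) p
      ¬v (inj₂ (inj₁ p)) = not-at (v~x s) p
      ¬v (inj₂ (inj₂ p)) = not-at (v~y s) p
      ¬x : ¬ Near s (x t)
      ¬x (inj₁ p)        = other-block (inj₂ (v~x t)) p
      ¬x (inj₂ (inj₁ p)) = xt∉ (∈-++⁺ˡ (exit (v~x s) p))
      ¬x (inj₂ (inj₂ p)) = xt∉ (∈-++⁺ʳ (exits G (v s) (x s)) (exit (v~y s) p))

    centre? : Decidable Centre
    centre? v = α v Fin.≟ zero

    centres : List (Fin n)
    centres = filter centre? (allFin n)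

    length-concatMap-closed : ∀ vs → length (concatMap (closed G) vs) ≤ length vs * suc (maxDegree G)
    length-concatMap-closed [] = z≤n
    length-concatMap-closed (v ∷ vs) = ℕ.≤-trans
      (ℕ.≤-reflexive (length-++ (closed G v)))
      (ℕ.+-mono-≤ (s≤s (degree≤maxDegree G v)) (length-concatMap-closed vs))

    n≤centres : n ≤ length centres * suc (maxDegree G)
    n≤centres = begin
      n                                        ≡⟨ length-tabulate {n = n} id ⟨
      length (allFin n)                        ≤⟨ unique-⊆⇒length-≤ (allFin⁺ n) (λ {u} _ → covered u) ⟩
      length (concatMap (closed G) centres)    ≤⟨ length-concatMap-closed centres ⟩
      length centres * suc (maxDegree G)       ∎
      where
      open ℕ.≤-Reasoning
      covered : ∀ u → u ∈ concatMap (closed G) centres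
      covered u with frozen u zero
      ... | v , v∈ , αv≡0 = ∈-concatMap⁺ (closed G)
        (Any.map (λ { refl → ∈-closed⁺ G (∈N-sym G v∈) }) (∈-filter⁺ centre? (∈-allFin v) αv≡0))

    open Sort (On.decTotalOrder ℕ.≤-decTotalOrder (length ∘ movables G))

    greedy-sites : Connected G → suc (maxDegree G) ℕ.< n → ∃ λ J → AllPairs Avoids J ×
      1 * (length (sort centres) + 0) ≤ 1 * (3 * length J) + 0
    greedy-sites conn Δ<n = greedy Fin._≟_ Centre (movables G) movables! movables#
      (v ∘ proj₁) (x ∘ proj₁) killed site-at
      -- Weight `1` is admissible because every centre has a movable neighbour. With nothing yet
      -- killed or picked, the bound says that at least a third of the blocks receive a site.
      (sort centres) [] [] 1
      (All.tabulate λ v∈ → proj₂ (∈-filter⁻ centre? {xs = allFin n} (∈-resp-↭ (sort-↭ centres) v∈)))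
      (Linked.Linked⇒AllPairs ℕ.≤-trans (sort-↗ centres))
      (Permutation.Unique-resp-↭ (setoid (Fin n)) (↭⇒↭ₛ (↭-sym (sort-↭ centres)))
        (filter⁺ centre? (allFin⁺ n)))
      (All.tabulate λ {v} _ → movables-nonempty G conn Δ<n v (λ x → degree-≤ G α frozen x v))
      (λ _ _ _ → []) []
    many-sites : Connected G → suc (maxDegree G) ℕ.< n →
      ∃ λ J → AllPairs (Untouched G) J × n ≤ 3 * length J * suc (maxDegree G)
    many-sites conn Δ<n = let J , J! , bound = greedy-sites conn Δ<n in
      map proj₁ J , AllPairs.map⁺ (AllPairs.map (λ {t} {s} → avoids⇒untouched {t} {s}) J!) , (begin
        n                                             ≤⟨ n≤centres ⟩
        length centres * suc (maxDegree G)            ≤⟨ ℕ.*-monoˡ-≤ (suc (maxDegree G)) (third J bound) ⟩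
        3 * length J * suc (maxDegree G)              ≡⟨ cong (λ j → 3 * j * suc (maxDegree G)) (length-map proj₁ J) ⟨
        3 * length (map proj₁ J) * suc (maxDegree G)  ∎)
      where
      open ℕ.≤-Reasoning
      third : ∀ (J : List CentredSite) →
        1 * (length (sort centres) + 0) ≤ 1 * (3 * length J) + 0 → length centres ≤ 3 * length J
      third J bound = begin
        length centres                   ≡⟨ ↭-length (sort-↭ centres) ⟨
        length (sort centres)            ≡⟨ ℕ.+-identityʳ _ ⟨
        length (sort centres) + 0        ≡⟨ ℕ.*-identityˡ _ ⟨
        1 * (length (sort centres) + 0)  ≤⟨ bound ⟩
        1 * (3 * length J) + 0           ≡⟨ ℕ.+-identityʳ _ ⟩
        1 * (3 * length J)               ≡⟨ ℕ.*-identityˡ _ ⟩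
        3 * length J                     ∎

    -- `α` serves only to find the list `J`. Sites and `Untouched` concern the graph alone, so
    -- `frozen-swappable` makes every proper frozen colouring `Good J`.
    frozen-count : Connected G → suc (maxDegree G) ℕ.< n →
      ∃ λ k → n ≤ 3 * k * suc (maxDegree G) ×
        2 ^ k * length (filter (frozen? G) (Ω G)) ≤ length (Ω G)
    frozen-count conn Δ<n = let J , J! , bound = many-sites conn Δ<n in length J , bound , (begin
      2 ^ length J * length (filter (frozen? G) (Ω G))  ≤⟨ ℕ.*-monoʳ-≤ (2 ^ length J)
        (length-filter-filter-map (frozen? G) (proper? G) (good? G J ∘ finToFun) finToFun
          (λ c pr fr → pr , All.tabulate (λ {s} _ → frozen-swappable (finToFun c) fr pr s))
          (allFin _)) ⟩
      2 ^ length J * count (good? G J)                  ≤⟨ count-good G J J! ⟩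
      count (good? G [])                                ≤⟨ length-filter-map (good? G [] ∘ finToFun) (proper? G)
                                                             finToFun (λ _ → proj₁) (allFin _) ⟩
      length (Ω G)                                      ∎)
      where open ℕ.≤-Reasoning

-- Powers and fractions of rationals.

infixr 8 _^ℚ_
_^ℚ_ : ℚ → ℕ → ℚ
_^ℚ_ = RawSemiring._^_ ℚ.+-*-rawSemiring

^ℚ-assoc : ∀ a m n → (a ^ℚ m) ^ℚ n ≡ a ^ℚ (m * n)
^ℚ-assoc = Exp.^-assocʳ (CommutativeRing.semiring ℚ.+-*-commutativeRing)

*-mono-≤ : ∀ {a b c d} → 0ℚ ℚ.≤ a → 0ℚ ℚ.≤ d → a ℚ.≤ b → c ℚ.≤ d → a ℚ.* c ℚ.≤ b ℚ.* d
*-mono-≤ {a} {b} {c} {d} 0≤a 0≤d a≤b c≤d = ℚ.≤-trans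
  (ℚ.*-monoˡ-≤-nonNeg a {{ℚ.nonNegative 0≤a}} c≤d)
  (ℚ.*-monoʳ-≤-nonNeg d {{ℚ.nonNegative 0≤d}} a≤b)

^ℚ-nonNeg : ∀ {a} → 0ℚ ℚ.≤ a → ∀ n → 0ℚ ℚ.≤ a ^ℚ n
^ℚ-nonNeg 0≤a zero    = from-yes (0ℚ ℚ.≤? 1ℚ)
^ℚ-nonNeg {a} 0≤a (suc n) = subst (ℚ._≤ a ℚ.* a ^ℚ n) (ℚ.*-zeroʳ a)
  (ℚ.*-monoˡ-≤-nonNeg a {{ℚ.nonNegative 0≤a}} (^ℚ-nonNeg 0≤a n))

^ℚ-monoˡ-≤ : ∀ {a b} → 0ℚ ℚ.≤ a → a ℚ.≤ b → ∀ n → a ^ℚ n ℚ.≤ b ^ℚ n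
^ℚ-monoˡ-≤ 0≤a a≤b zero    = ℚ.≤-refl
^ℚ-monoˡ-≤ 0≤a a≤b (suc n) =
  *-mono-≤ 0≤a (^ℚ-nonNeg (ℚ.≤-trans 0≤a a≤b) n) a≤b (^ℚ-monoˡ-≤ 0≤a a≤b n)

^ℚ-antitoneʳ : ∀ {a} → 0ℚ ℚ.≤ a → a ℚ.≤ 1ℚ → ∀ {m n} → m ≤ n → a ^ℚ n ℚ.≤ a ^ℚ m
^ℚ-antitoneʳ 0≤a a≤1 {n = zero}  z≤n = ℚ.≤-refl
^ℚ-antitoneʳ {a} 0≤a a≤1 {n = suc n} z≤n = subst (a ^ℚ suc n ℚ.≤_) (ℚ.*-identityˡ 1ℚ)
  (*-mono-≤ 0≤a (from-yes (0ℚ ℚ.≤? 1ℚ)) a≤1 (^ℚ-antitoneʳ 0≤a a≤1 {n = n} z≤n))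
^ℚ-antitoneʳ {a} 0≤a a≤1 (s≤s m≤n) = ℚ.*-monoˡ-≤-nonNeg a {{ℚ.nonNegative 0≤a}}
  (^ℚ-antitoneʳ 0≤a a≤1 m≤n)

/-nonNeg : ∀ m n .{{_ : ℕ.NonZero n}} → 0ℚ ℚ.≤ + m / n
/-nonNeg m n = ℚ.nonNegative⁻¹ (+ m / n) {{ℚ.normalize-nonNeg m n}}

/-≤-1 : ∀ {m n} .{{_ : ℕ.NonZero n}} → m ≤ n → + m / n ℚ.≤ 1ℚ
/-≤-1 {m} {suc n} m≤n = ℚ.toℚᵘ-cancel-≤ (ℚᵘ.≤-trans
  (ℚᵘ.≤-reflexive (ℚ.toℚᵘ-fromℚᵘ (mkℚᵘ (+ m) n)))
  (*≤* (subst₂ ℤ._≤_ (sym (ℤ.*-identityʳ (+ m))) (sym (ℤ.*-identityˡ (+ suc n))) (+≤+ m≤n))))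

/-halve : ∀ m n .{{_ : ℕ.NonZero n}} → + m / n ≡ ½ ℚ.* (+ (2 * m) / n)
/-halve m (suc n) = ℚ.toℚᵘ-injective (begin
  ℚ.toℚᵘ (+ m / suc n)                            ≈⟨ ℚ.toℚᵘ-fromℚᵘ (mkℚᵘ (+ m) n) ⟩
  mkℚᵘ (+ m) n                                    ≈⟨ *≡* cross ⟩
  ℚ.toℚᵘ ½ ℚᵘ.* mkℚᵘ (+ (2 * m)) n                ≈⟨ ℚᵘ.*-congˡ {ℚ.toℚᵘ ½} (ℚ.toℚᵘ-fromℚᵘ (mkℚᵘ (+ (2 * m)) n)) ⟨
  ℚ.toℚᵘ ½ ℚᵘ.* ℚ.toℚᵘ (+ (2 * m) / suc n)        ≈⟨ ℚ.toℚᵘ-homo-* ½ (+ (2 * m) / suc n) ⟨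
  ℚ.toℚᵘ (½ ℚ.* (+ (2 * m) / suc n))              ∎)
  where
  open import Relation.Binary.Reasoning.Setoid ℚᵘ.≃-setoid
  e : ∀ m n → m * (2 * suc n) ≡ (2 * m) * suc n
  e = solve-∀
  cross : + m ℤ.* + (2 * suc n) ≡ (+ 1 ℤ.* + (2 * m)) ℤ.* + suc n
  cross = trans (sym (ℤ.pos-* m (2 * suc n))) (trans (cong +_ (e m n))
    (trans (ℤ.pos-* (2 * m) (suc n)) (cong (ℤ._* + suc n) (sym (ℤ.*-identityˡ (+ (2 * m)))))))

-- The factors `2` move one at a time into the numerator, each at the price of a factor `½`, which
-- is at most `a`.
/-≤-power : ∀ {a} → ½ ℚ.≤ a → ∀ k {m n} .{{_ : ℕ.NonZero n}} →
  2 ℕ.^ k * m ≤ n → + m / n ℚ.≤ a ^ℚ k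
/-≤-power ½≤a zero {m} h = /-≤-1 (subst (_≤ _) (ℕ.+-identityʳ m) h)
/-≤-power {a} ½≤a (suc k) {m} {n} h = subst (ℚ._≤ a ^ℚ suc k) (sym (/-halve m n))
  (*-mono-≤ (from-yes (0ℚ ℚ.≤? ½)) (^ℚ-nonNeg (ℚ.≤-trans (from-yes (0ℚ ℚ.≤? ½)) ½≤a) k) ½≤a
    (/-≤-power ½≤a k (subst (_≤ n) (e (2 ℕ.^ k) m) h)))
  where
  e : ∀ a b → 2 * a * b ≡ a * (2 * b)
  e = solve-∀

-- The power `D` clears the root and gives the exponent `3 * k * D`; lowering it to `n` can only
-- increase a power of a base between `0` and `1`.
power-≤ : ∀ {p} k D n → 0ℚ ℚ.≤ p → p ℚ.≤ ((+ 6 / 7) ^ℚ 3) ^ℚ k → n ≤ 3 * k * D →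
  p ^ℚ D ℚ.≤ (+ 6 / 7) ^ℚ n
power-≤ {p} k D n 0≤p p≤ n≤ = begin
  p ^ℚ D                               ≤⟨ ^ℚ-monoˡ-≤ 0≤p p≤ D ⟩
  (((+ 6 / 7) ^ℚ 3) ^ℚ k) ^ℚ D         ≡⟨ cong (_^ℚ D) (^ℚ-assoc (+ 6 / 7) 3 k) ⟩
  ((+ 6 / 7) ^ℚ (3 * k)) ^ℚ D          ≡⟨ ^ℚ-assoc (+ 6 / 7) (3 * k) D ⟩
  (+ 6 / 7) ^ℚ (3 * k * D)             ≤⟨ ^ℚ-antitoneʳ (from-yes (0ℚ ℚ.≤? + 6 / 7))
                                            (from-yes (+ 6 / 7 ℚ.≤? 1ℚ)) n≤ ⟩
  (+ 6 / 7) ^ℚ n                       ∎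
  where open ℚ.≤-Reasoning

-- Truncation makes `n ∸ 2` equal to `0` for `n` below `2`; positivity of `m` rules these cases out.
≤∸2⇒suc< : ∀ {m} n → 0 ℕ.< m → m ≤ n ∸ 2 → suc m ℕ.< n
≤∸2⇒suc< zero          (s≤s _) ()
≤∸2⇒suc< (suc zero)    (s≤s _) ()
≤∸2⇒suc< (suc (suc n)) _       m≤n = s≤s (s≤s m≤n)

theorem1 : (Δ n : ℕ) → 3 ≤ Δ → Δ ≤ n ∸ 2 →
    (G : Graph n) → Connected G → maxDegree G ≡ Δ →
    ℙ G (frozen? G) ≤ (+ 6 / 7) ^[ n / suc Δ ]
theorem1 Δ n 3≤Δ Δ≤n∸2 G connected refl = let k , n≤ , few = sparse in
  power-≤ k (suc Δ) n (/-nonNeg frozen# Ω# {{Ω-nonZero G}})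
    -- `(6/7)^3` is `216/343`, just above one half; the exponent `3` offsets the loss of two blocks
    -- in three.
    (/-≤-power (from-yes (½ ℚ.≤? (+ 6 / 7) ^ℚ 3)) k {{Ω-nonZero G}} few) n≤
  where
  frozen# = length (filter (frozen? G) (Ω G))
  Ω# = length (Ω G)
  sparse : ∃ λ k → n ≤ 3 * k * suc Δ × 2 ℕ.^ k * frozen# ≤ Ω#
  sparse with filter (frozen? G) (Ω G) in eq
  -- Without frozen colourings the count is `0`, so any `k` satisfies the second bound; `k = n` is
  -- large enough for the first.
  ... | [] = n , ℕ.≤-trans (ℕ.m≤n*m n 3) (ℕ.m≤m*n (3 * n) (suc Δ)) ,
    subst (_≤ Ω#) (sym (ℕ.*-zeroʳ (2 ℕ.^ n))) z≤n
  ... | α ∷ _ with ∈-filter⁻ (frozen? G) {xs = Ω G} (subst (α ∈_) (sym eq) (here refl))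
  ...   | α∈Ω , frozen = subst (λ l → ∃ λ k → n ≤ 3 * k * suc Δ × 2 ℕ.^ k * length l ≤ Ω#) eq
    (frozen-count G α frozen connected (≤∸2⇒suc< n (ℕ.≤-trans (s≤s z≤n) 3≤Δ) Δ≤n∸2))
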